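{- $t(n)\in\Omega\left(n^2/\log(n)\right)$.
   Context: Let $\mathfrak{C}=\{0,1\}^n$ be the vertex set of the $n$-dimensional hypercube; $\oplus,\wedge$ denote bitwise XOR and AND. An outmap is any function $s:\mathfrak{C}\to\{0,1\}^n$. A clash of $s$ is a pair of distinct vertices $u,v$ with $(s(u)\oplus s(v))\wedge(u\oplus v)=0^n$. A query at $u$ to the oracle for $s$ returns $s(u)$; algorithms choose queries adaptively, and only the number of queries is counted. \textsc{Sink-or-Clash}: given oracle access to an arbitrary outmap $s$, query either a vertex $u$ with $s(u)=0^n$ or both vertices of some clash. $t(n)=\min_{\mathcal A}\max_s t(\mathcal A,s)$, where $\mathcal A$ ranges over deterministic algorithms solving \textsc{Sink-or-Clash} on all outmaps of the $n$-cube and $t(\mathcal A,s)$ is the number of queries made on $s$. -}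

module Defs where

open import Data.Bool.Base using (Bool; true; false; _xor_; _∧_)
open import Data.Bool.Properties using (xor-same; ∧-zeroˡ)
import Data.Bool.Properties as Bool
open import Data.Fin.Base as Fin using (Fin; zero; suc; combine; remQuot)
import Data.Fin.Properties as Fin
open import Data.Integer.Base using (+_)
open import Data.List.Base as List using (List; []; _∷_; length)
open import Data.List.Membership.Propositional using (lose)
open import Data.List.Membership.Propositional.Properties using (∈-map⁺; ∈-allFin)
import Data.List.Relation.Unary.Any as Any
open Any using (Any; any?)
open import Data.Nat.Base as ℕ using (ℕ; zero; suc; _≤_; z≤n; s≤s; s≤s⁻¹; _^_)
import Data.Nat.Properties as ℕ
open import Data.Nat.Logarithm using (⌊log₂_⌋)
open import Data.Product.Base using (Σ; ∃; ∃₂; ∃-syntax; _×_; _,_; proj₁; proj₂)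
open import Data.Rational.Base as ℚ using (ℚ; 0ℚ)
open import Data.Sum.Base as Sum using (_⊎_; inj₁; inj₂)
open import Data.Vec.Base using (Vec; []; _∷_; zipWith; replicate)
open import Data.Vec.Properties using (≡-dec)
open import Function.Base using (_∘_; const)
open import Relation.Binary.PropositionalEquality
  using (_≡_; _≢_; _≗_; refl; sym; trans; cong; cong₂; subst)
open import Relation.Nullary using (¬_; Dec; yes; no; contradiction)
open import Relation.Nullary.Decidable using (map′; decidable-stable; ¬?; _⊎-dec_; _×-dec_)
open import Relation.Unary using (Decidable)

------------------------------------------------------------------------
-- Outmaps of the cube

Vertex : ℕ → Set
Vertex n = Vec Bool n

Outmap : ℕ → Set
Outmap n = Vertex n → Vec Bool n

_⊕_ : ∀ {n} → Vec Bool n → Vec Bool n → Vec Bool n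
_⊕_ = zipWith _xor_

_⊗_ : ∀ {n} → Vec Bool n → Vec Bool n → Vec Bool n
_⊗_ = zipWith _∧_

0ⁿ : ∀ {n} → Vec Bool n
0ⁿ = replicate _ false

Sink : ∀ {n} → Outmap n → Vertex n → Set
Sink s u = s u ≡ 0ⁿ

Clash : ∀ {n} → Outmap n → Vertex n → Vertex n → Set
Clash s u v = u ≢ v × ((s u ⊕ s v) ⊗ (u ⊕ v)) ≡ 0ⁿ

------------------------------------------------------------------------
-- Deterministic query algorithms

-- Only queries are counted, so an algorithm is a decision tree: it stops,
-- or it queries a vertex and continues in a way that depends on the answer.
-- A vertex may be queried again, and is then counted again.
data Algorithm (n : ℕ) : Set where
  stop  : Algorithm n
  query : Vertex n → (Vec Bool n → Algorithm n) → Algorithm n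

queried : ∀ {n} → Algorithm n → Outmap n → List (Vertex n)
queried stop           s = []
queried (query u next) s = u ∷ queried (next (s u)) s

cost : ∀ {n} → Algorithm n → Outmap n → ℕ
cost A s = length (queried A s)

Found : ∀ {n} → Outmap n → List (Vertex n) → Set
Found s us = Any (Sink s) us ⊎ Any (λ u → Any (Clash s u) us) us

Solves : ∀ {n} → Algorithm n → Set
Solves A = ∀ s → Found s (queried A s)

------------------------------------------------------------------------
-- The query complexity t

IsLeast : (ℕ → Set) → ℕ → Set
IsLeast P m = P m × (∀ k → P k → m ≤ k)

IsGreatest : (ℕ → Set) → ℕ → Set
IsGreatest P m = P m × (∀ k → P k → k ≤ m)

-- max_s t(A , s) = m
WorstCase : ∀ {n} → Algorithm n → ℕ → Set
WorstCase A = IsGreatest (λ k → ∃[ s ] cost A s ≡ k)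

-- min_A max_s t(A , s) = m
MinWorstCase : ℕ → ℕ → Set
MinWorstCase n = IsLeast (λ k → Σ (Algorithm n) λ A → Solves A × WorstCase A k)

-- The rest of this section shows that the minimum and maximum exist.
private

  -- Querying every vertex solves the problem, by the pigeonhole principle.

  bit : Bool → Fin 2
  bit false = zero
  bit true  = suc zero

  unbit : Fin 2 → Bool
  unbit zero    = false
  unbit (suc _) = true

  bit-unbit : ∀ i → bit (unbit i) ≡ i
  bit-unbit zero       = refl
  bit-unbit (suc zero) = refl

  bit-injective : ∀ a b → bit a ≡ bit b → a ≡ b
  bit-injective false false _ = refl
  bit-injective true  true  _ = refl

  encode : ∀ {n} → Vec Bool n → Fin (2 ^ n)
  encode []      = zero
  encode (b ∷ v) = combine (bit b) (encode v)

  encode-injective : ∀ {n} (u v : Vec Bool n) → encode u ≡ encode v → u ≡ v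
  encode-injective []      []      _  = refl
  encode-injective (a ∷ u) (b ∷ v) eq =
    let eq₁ , eq₂ = Fin.combine-injective (bit a) (encode u) (bit b) (encode v) eq
    in cong₂ _∷_ (bit-injective a b eq₁) (encode-injective u v eq₂)

  decode : ∀ n → Fin (2 ^ n) → Vec Bool n
  decode zero    _ = []
  decode (suc n) i =
    unbit (proj₁ (remQuot {2} (2 ^ n) i)) ∷ decode n (proj₂ (remQuot {2} (2 ^ n) i))

  encode-decode : ∀ n i → encode (decode n i) ≡ i
  encode-decode zero    zero = refl
  encode-decode (suc n) i    = trans
    (cong₂ combine (bit-unbit (proj₁ (remQuot {2} (2 ^ n) i)))
                   (encode-decode n (proj₂ (remQuot {2} (2 ^ n) i))))
    (Fin.combine-remQuot {2} (2 ^ n) i)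

  vertices : ∀ n → List (Vertex n)
  vertices n = List.map (decode n) (List.allFin (2 ^ n))

  same⇒⊗≡0 : ∀ {n} (x : Vec Bool n) (y : Vec Bool n) → ((x ⊕ x) ⊗ y) ≡ 0ⁿ
  same⇒⊗≡0 []      []      = refl
  same⇒⊗≡0 (a ∷ x) (b ∷ y) =
    cong₂ _∷_ (trans (cong (_∧ b) (xor-same a)) (∧-zeroˡ b)) (same⇒⊗≡0 x y)

  found-vertices : ∀ {n} (s : Outmap n) → Found s (vertices n)
  found-vertices {n} s = conclude (Fin.pigeonhole (ℕ.n<1+n (2 ^ n)) f)
    where
    f : Fin (suc (2 ^ n)) → Fin (2 ^ n)
    f zero    = encode (0ⁿ {n})
    f (suc i) = encode (s (decode n i))

    member = λ i → ∈-map⁺ (decode n) (∈-allFin {2 ^ n} i)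

    conclude : (∃₂ λ i j → i Fin.< j × f i ≡ f j) → Found s (vertices n)
    conclude (zero  , suc j , _   , eq) =
      inj₁ (lose (member j) (sym (encode-injective 0ⁿ _ eq)))
    conclude (suc i , suc j , i<j , eq) =
      inj₂ (lose (member i) (lose (member j) (distinct , clash)))
      where
      distinct : decode n i ≢ decode n j
      distinct e = Fin.<⇒≢ i<j (cong suc
        (trans (sym (encode-decode n i)) (trans (cong encode e) (encode-decode n j))))

      clash : ((s (decode n i) ⊕ s (decode n j)) ⊗ (decode n i ⊕ decode n j)) ≡ 0ⁿ
      clash rewrite encode-injective (s (decode n i)) (s (decode n j)) eq =
        same⇒⊗≡0 (s (decode n j)) _

  queryAll : ∀ {n} → List (Vertex n) → Algorithm n
  queryAll []       = stop
  queryAll (u ∷ us) = query u (const (queryAll us))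

  queried-queryAll : ∀ {n} us (s : Outmap n) → queried (queryAll us) s ≡ us
  queried-queryAll []       s = refl
  queried-queryAll (u ∷ us) s = cong (u ∷_) (queried-queryAll us s)

  -- Algorithms cut off after k queries

  cut : ∀ {n} → ℕ → Algorithm n → Algorithm n
  cut zero    _              = stop
  cut (suc k) stop           = stop
  cut (suc k) (query u next) = query u (cut k ∘ next)

  cost-cut : ∀ {n} k (A : Algorithm n) s → cost (cut k A) s ≤ k
  cost-cut zero    _              s = z≤n
  cost-cut (suc k) stop           s = z≤n
  cost-cut (suc k) (query u next) s = s≤s (cost-cut k (next (s u)) s)

  queried-cut : ∀ {n} k (A : Algorithm n) s → cost A s ≤ k →
                queried (cut k A) s ≡ queried A s
  queried-cut zero    stop           s _  = refl
  queried-cut (suc k) stop           s _  = refl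
  queried-cut (suc k) (query u next) s le =
    cong (u ∷_) (queried-cut k (next (s u)) s (s≤s⁻¹ le))

  -- Exhaustive search, for predicates that respect a relation

  Searchable : (X : Set) → (X → X → Set) → Set₁
  Searchable X _≈_ =
    ∀ {P : X → Set} → (∀ {x y} → x ≈ y → P x → P y) → Decidable P → Dec (∃ P)

  search-Vec : ∀ n → Searchable (Vec Bool n) _≡_
  search-Vec zero    resp P? = map′ ([] ,_) (λ { ([] , p) → p }) (P? [])
  search-Vec (suc n) resp P? = map′
    (Sum.[ (λ (v , p) → false ∷ v , p) , (λ (v , p) → true ∷ v , p) ]′)
    (λ { (false ∷ v , p) → inj₁ (v , p) ; (true ∷ v , p) → inj₂ (v , p) })
    (search-Vec n (resp ∘ cong (false ∷_)) (P? ∘ (false ∷_))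
      ⊎-dec search-Vec n (resp ∘ cong (true ∷_)) (P? ∘ (true ∷_)))

  join : ∀ {n} {Y : Set} → (Vec Bool n → Y) → (Vec Bool n → Y) → Vec Bool (suc n) → Y
  join f g (false ∷ v) = f v
  join f g (true  ∷ v) = g v

  search-→ : ∀ {Y : Set} {_≈_ : Y → Y → Set} → (∀ {y} → y ≈ y) → Searchable Y _≈_ →
             ∀ n → Searchable (Vec Bool n → Y) (λ f g → ∀ v → f v ≈ g v)
  search-→ ≈-refl search zero resp P? = map′
    (λ (y , p) → const y , p)
    (λ (f , p) → f [] , resp (λ { [] → ≈-refl }) p)
    (search (λ e → resp (λ _ → e)) (P? ∘ const))
  search-→ ≈-refl search (suc n) resp P? = map′
    (λ (f , g , p) → join f g , p)
    (λ (h , p) → h ∘ (false ∷_) , h ∘ (true ∷_) ,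
                 resp (λ { (false ∷ v) → ≈-refl ; (true ∷ v) → ≈-refl }) p)
    (search-→ ≈-refl search n
      (λ e (g , p) → g , resp (λ { (false ∷ v) → e v ; (true ∷ v) → ≈-refl }) p)
      (λ f → search-→ ≈-refl search n
        (λ e → resp (λ { (false ∷ v) → ≈-refl ; (true ∷ v) → e v }))
        (λ g → P? (join f g))))

  search-Outmap : ∀ n → Searchable (Outmap n) _≗_
  search-Outmap n = search-→ refl (search-Vec n) n

  _≈[_]_ : ∀ {n} → Algorithm n → ℕ → Algorithm n → Set
  A ≈[ k ] B = ∀ s → queried (cut k A) s ≡ queried (cut k B) s

  search-Algorithm : ∀ {n} k → Searchable (Algorithm n) _≈[ k ]_
  search-Algorithm     zero    resp P? =
    map′ (stop ,_) (λ (A , p) → resp (λ _ → refl) p) (P? stop)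
  search-Algorithm {n} (suc k) resp P? = map′
    (Sum.[ (stop ,_) , (λ (u , next , p) → query u next , p) ]′)
    (λ { (stop , p) → inj₁ p ; (query u next , p) → inj₂ (u , next , p) })
    (P? stop ⊎-dec search-Vec n (λ { refl p → p }) (λ u →
      search-→ (λ _ → refl) (search-Algorithm k) n
        (λ e → resp (λ s → cong (u ∷_) (e (s u) s)))
        (P? ∘ query u)))

  -- Existence of the minimum

  queried-cong : ∀ {n} (A : Algorithm n) {s s′} → s ≗ s′ → queried A s ≡ queried A s′
  queried-cong stop               e = refl
  queried-cong (query u next) {s} e rewrite sym (e u) =
    cong (u ∷_) (queried-cong (next (s u)) e)

  Found-resp : ∀ {n} {s s′ : Outmap n} {us} → s ≗ s′ → Found s us → Found s′ us
  Found-resp {s = s} {s′} e = Sum.map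
    (Any.map (λ {u} p → trans (sym (e u)) p))
    (Any.map (λ {u} → Any.map (λ {v} (u≢v , p) → u≢v ,
      trans (cong₂ (λ x y → (x ⊕ y) ⊗ (u ⊕ v)) (sym (e u)) (sym (e v))) p)))

  Found? : ∀ {n} (s : Outmap n) → Decidable (Found s)
  Found? s us =
    any? (λ u → s u ≟ 0ⁿ) us ⊎-dec
    any? (λ u → any? (λ v → ¬? (u ≟ v) ×-dec (((s u ⊕ s v) ⊗ (u ⊕ v)) ≟ 0ⁿ)) us) us
    where
    _≟_ = ≡-dec Bool._≟_

  Solves? : ∀ {n} → Decidable (Solves {n})
  Solves? {n} A = map′
    (λ none s → decidable-stable (Found? s _) (λ ¬p → none (s , ¬p)))
    (λ all (s , ¬p) → ¬p (all s))
    (¬? (search-Outmap n resp (λ s → ¬? (Found? s (queried A s)))))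
    where
    resp : ∀ {s s′} → s ≗ s′ → ¬ Found s (queried A s) → ¬ Found s′ (queried A s′)
    resp {s} {s′} e ¬p p = ¬p (Found-resp (sym ∘ e)
      (subst (Found s′) (sym (queried-cong A e)) p))

  SolvableIn : ℕ → ℕ → Set
  SolvableIn n k = Σ (Algorithm n) λ A → Solves (cut k A)

  SolvableIn? : ∀ n → Decidable (SolvableIn n)
  SolvableIn? n k = search-Algorithm k
    (λ e p s → subst (Found s) (e s) (p s))
    (Solves? ∘ cut k)

  solvableIn : ∀ {n} {A : Algorithm n} k → Solves A → (∀ s → cost A s ≤ k) → SolvableIn n k
  solvableIn {A = A} k solves le =
    A , λ s → subst (Found s) (sym (queried-cut k A s (le s))) (solves s)

  least : ∀ {P : ℕ → Set} → Decidable P → ∀ K → P K → ∃ (IsLeast P)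
  least P? zero    p = zero , p , λ _ _ → z≤n
  least P? (suc K) p with P? zero | least (P? ∘ suc) K p
  ... | yes p₀ | _            = zero , p₀ , λ _ _ → z≤n
  ... | no ¬p₀ | m , pₘ , min =
    suc m , pₘ , λ { zero p₀ → contradiction p₀ ¬p₀ ; (suc k) pₖ → s≤s (min k pₖ) }

  leastSolvable : ∀ n → ∃ (IsLeast (SolvableIn n))
  leastSolvable n = least (SolvableIn? n) (length (vertices n))
    (solvableIn {A = queryAll (vertices n)} _
      (λ s → subst (Found s) (sym (queried-queryAll (vertices n) s)) (found-vertices s))
      (λ s → ℕ.≤-reflexive (cong length (queried-queryAll (vertices n) s))))

  cost-attained : ∀ {n} k {A : Algorithm n} → Solves A → (∀ s → cost A s ≤ k) →
                  (∀ j → SolvableIn n j → k ≤ j) → ∃[ s ] cost A s ≡ k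
  cost-attained zero solves le min = const 0ⁿ , ℕ.n≤0⇒n≡0 (le _)
  cost-attained {n} (suc k) {A} solves le min = decidable-stable
    (search-Outmap n (λ e → trans (cong length (sym (queried-cong A e))))
                     (λ s → cost A s ℕ.≟ suc k))
    (λ none → ℕ.1+n≰n (min k (solvableIn k solves
      (λ s → s≤s⁻¹ (ℕ.≤∧≢⇒< (le s) (λ eq → none (s , eq)))))))

minWorstCase : ∀ n → ∃ (MinWorstCase n)
minWorstCase n with k , (A , solves) , min ← leastSolvable n =
  k ,
  ( cut k A
  , solves
  , cost-attained k solves (cost-cut k A) min
  , λ { _ (s , refl) → cost-cut k A s }) ,
  λ { m (B , solvesB , _ , max) → min m (solvableIn m solvesB (λ s → max _ (s , refl))) }

t : ℕ → ℕ
t n = proj₁ (minWorstCase n)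

t-minWorstCase : ∀ n → MinWorstCase n (t n)
t-minWorstCase n = proj₂ (minWorstCase n)

------------------------------------------------------------------------
-- Asymptotics

fromℕ : ℕ → ℚ
fromℕ n = + n ℚ./ 1

_∈Ω_ : (ℕ → ℕ) → (ℕ → ℚ) → Set
f ∈Ω g = ∃[ c ] (0ℚ ℚ.< c × ∃[ N ] (∀ n → N ≤ n → c ℚ.* g n ℚ.≤ fromℕ (f n)))

-- Totalised division: the value for a zero divisor is a dummy.
_÷_ : ℕ → ℕ → ℚ
m ÷ zero  = 0ℚ
m ÷ suc d = + m ℚ./ suc d

-- For n ≥ 2 we have ⌊log₂ n⌋ ≤ log₂ n ≤ 2 ⌊log₂ n⌋, so rounding the logarithm
-- (like the choice of its base) does not affect Ω(n² / log n).  The dummy value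
-- of the quotient only occurs for n ≤ 1.
n²/log : ℕ → ℚ
n²/log n = (n ^ 2) ÷ ⌊log₂ n ⌋

{-# OPTIONS --safe #-}
module Submission where

-- An adversary, following Schurr and Szabó. It keeps a growing set of labels
-- and a clash-free outmap on the cube of the labels, and answers each query by
-- this outmap on the labels and by 1 elsewhere. A query that has the same
-- labels as an earlier one costs one new label, in which the two differ; the
-- edges of this label are directed away from the earlier queries, whose answers
-- thus stand.
-- If 2^d exceeds the number m of queries, then fixing d coordinates that are
-- not labels leaves a subcube F′ without queries. Every query has outgoing
-- edges in all of these directions, so the outmap can be completed outside F′
-- such that each vertex there has an outgoing edge in a direction leading
-- towards F′. Whatever happens inside F′ is then unconstrained, and the
-- adversary starts afresh in F′. With m = ⌊n/2⌋ and d = ⌊log₂ n⌋ there are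
-- ⌊m/d⌋ rounds of m queries.

open import Defs
open import Data.Bool.Base using (Bool; true; false; not; if_then_else_; _xor_; _∧_)
import Data.Bool.Properties as Bool
open import Data.Fin.Base using (Fin)
import Data.Fin.Properties as Fin
import Data.Integer.Base as ℤ
import Data.Integer.Properties as ℤ
open import Data.List.Base using (List; []; _∷_; _++_; length; filter; take)
import Data.List.Membership.DecPropositional as DecMembership
open import Data.List.Membership.Propositional using (_∈_; _∉_; find; lose)
open import Data.List.Membership.Propositional.Properties using (∈-++⁺ˡ; ∈-++⁺ʳ; ∈-++⁻)
open import Data.List.Membership.Setoid.Properties using (index-injective)
open import Data.List.Properties using (length-++; take-all)
open import Data.List.Relation.Unary.All as All using (All; []; _∷_; all?)
open import Data.List.Relation.Unary.All.Properties using (¬All⇒Any¬)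
open import Data.List.Relation.Unary.Any as Any using (Any; here; there; any?)
open import Data.Nat.Base
open import Data.Nat.DivMod using (m/n*n≤m; m≡m%n+[m/n]*n; m%n≤n; m≥n⇒m/n>0)
open import Data.Nat.Induction using (<-rec)
open import Data.Nat.Logarithm
  using (⌊log₂_⌋; ⌊log₂⌋-mono-≤; ⌊log₂⌊n/2⌋⌋≡⌊log₂n⌋∸1; ⌊log₂[2^n]⌋≡n)
open import Data.Nat.Properties
open import Data.Nat.Solver using (module +-*-Solver)
open import Data.Product.Base using (Σ; ∃; ∃₂; _×_; _,_; proj₁)
import Data.Rational.Base as ℚ
import Data.Rational.Properties as ℚ
import Data.Rational.Unnormalised.Base as ℚᵘ
import Data.Rational.Unnormalised.Properties as ℚᵘ
open import Data.Sum.Base using (inj₁; inj₂)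
open import Data.Vec.Base using (Vec; lookup; tabulate; replicate; map; _[_]≔_)
open import Data.Vec.Properties
  using (lookup∘tabulate; tabulate∘lookup; tabulate-cong; lookup∘update; lookup∘update′;
         lookup-zipWith; lookup-replicate; lookup-map; ≡-dec)
open import Function.Base using (_∘_; const)
open import Relation.Binary.PropositionalEquality
open import Relation.Nullary using (¬_; Dec; yes; no; contradiction)
open import Relation.Nullary.Decidable using (does; dec-true; dec-false; ¬?; _×-dec_; decidable-stable; map′)

private
  variable
    n : ℕ
    i j : Fin n
    u v w f : Vertex n
    M G : List (Fin n)

open module FinMembership {n} = DecMembership (Fin._≟_ {n}) using (_∈?_)

-- Booleans, and agreement of vertices on a set of coordinates

≢⇒≡ : ∀ {a b c : Bool} → a ≢ c → b ≢ c → a ≡ b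
≢⇒≡ a≢c b≢c = trans (Bool.¬-not a≢c) (sym (Bool.¬-not b≢c))

true≢false : ∀ {a b} → a ≡ true → b ≡ false → a ≢ b
true≢false refl refl ()

≢⇒xor : ∀ {a b} → a ≢ b → a xor b ≡ true
≢⇒xor {false} {false} a≢b = contradiction refl a≢b
≢⇒xor {false} {true}  a≢b = refl
≢⇒xor {true}  {false} a≢b = refl
≢⇒xor {true}  {true}  a≢b = contradiction refl a≢b

xor-cancelʳ : ∀ a b c → a xor c ≡ b xor c → a ≡ b
xor-cancelʳ a b c eq = trans (lemma a) (trans (cong (_xor c) eq) (sym (lemma b)))
  where
  lemma : ∀ x → x ≡ (x xor c) xor c
  lemma x = sym (trans (Bool.xor-assoc x c c)
    (trans (cong (x xor_) (Bool.xor-same c)) (Bool.xor-identityʳ x)))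

record Agree (G : List (Fin n)) (u v : Vertex n) : Set where
  constructor mk
  field
    agrees : ∀ {i} → i ∈ G → lookup u i ≡ lookup v i

open Agree

agree? : (G : List (Fin n)) (u v : Vertex n) → Dec (Agree G u v)
agree? G u v = map′ (λ p → mk (All.lookup p)) (λ p → All.tabulate (agrees p))
  (all? (λ i → lookup u i Bool.≟ lookup v i) G)

Agree-refl : Agree G u u
Agree-refl = mk λ _ → refl

Agree-sym : Agree G u v → Agree G v u
Agree-sym p = mk λ i∈G → sym (agrees p i∈G)

Agree-trans : Agree G u v → Agree G v w → Agree G u w
Agree-trans p q = mk λ i∈G → trans (agrees p i∈G) (agrees q i∈G)

Agree-tail : Agree (j ∷ G) u v → Agree G u v
Agree-tail p = mk (agrees p ∘ there)

Differ : Vertex n → Vertex n → Fin n → Set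
Differ u v i = lookup u i ≢ lookup v i

_at_ : u ≡ v → ∀ i → lookup u i ≡ lookup v i
eq at i = cong (λ x → lookup x i) eq

¬Agree⇒Differ : ∀ G → ¬ Agree G u v → ∃ λ i → i ∈ G × Differ u v i
¬Agree⇒Differ G ¬p = find (¬All⇒Any¬ (λ i → _ Bool.≟ _) G (λ p → ¬p (mk (All.lookup p))))

lookup-ext : (∀ i → lookup u i ≡ lookup v i) → u ≡ v
lookup-ext {u = u} {v} eq =
  trans (sym (tabulate∘lookup u)) (trans (tabulate-cong eq) (tabulate∘lookup v))

≢⇒Differ : u ≢ v → ∃ (Differ u v)
≢⇒Differ {u = u} {v} u≢v with Fin.any? (λ i → ¬? (lookup u i Bool.≟ lookup v i))
... | yes p = p
... | no ¬p = contradiction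
  (lookup-ext (λ i → decidable-stable (_ Bool.≟ _) (λ ne → ¬p (i , ne)))) u≢v

-- Clash-free outmaps

Separates : Outmap n → Vertex n → Vertex n → Fin n → Set
Separates s u v i = Differ u v i × Differ (s u) (s v) i

Separated : Outmap n → Vertex n → Vertex n → Set
Separated s u v = ∃ (Separates s u v)

Separated-sym : ∀ {s : Outmap n} → Separated s u v → Separated s v u
Separated-sym (i , p , q) = i , p ∘ sym , q ∘ sym

ClashFree : Outmap n → Set
ClashFree s = ∀ {u v} → u ≢ v → Separated s u v

-- In a separating direction `i`, bit `i` of `(s u ⊕ s v) ⊗ (u ⊕ v)` is 1.
Separated⇒¬Clash : ∀ {s : Outmap n} → Separated s u v → ¬ Clash s u v
Separated⇒¬Clash {u = u} {v} {s} (i , p , q) (_ , eq) = true≢false refl refl (begin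
  true
    ≡⟨ cong₂ _∧_ (≢⇒xor q) (≢⇒xor p) ⟨
  (lookup (s u) i xor lookup (s v) i) ∧ (lookup u i xor lookup v i)
    ≡⟨ cong₂ _∧_ (lookup-zipWith _xor_ i (s u) (s v)) (lookup-zipWith _xor_ i u v) ⟨
  lookup (s u ⊕ s v) i ∧ lookup (u ⊕ v) i
    ≡⟨ lookup-zipWith _∧_ i (s u ⊕ s v) (u ⊕ v) ⟨
  lookup ((s u ⊕ s v) ⊗ (u ⊕ v)) i
    ≡⟨ eq at i ⟩
  lookup 0ⁿ i
    ≡⟨ lookup-replicate i false ⟩
  false
    ∎)
  where open ≡-Reasoning

¬Sink-by : ∀ (s : Outmap n) → lookup (s u) i ≡ true → ¬ Sink s u
¬Sink-by {i = i} s p eq =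
  true≢false p (lookup-replicate i false) (eq at i)

-- Outmaps and vectors defined by cases

abstract

  patch : List (Fin n) → Vertex n → Outmap n → Outmap n → Outmap n
  patch M f g s u = if does (agree? M f u) then g u else s u

  patch-in : ∀ {g s} → Agree M f u → patch M f g s u ≡ g u
  patch-in {M = M} {f = f} {u = u} p = cong (if_then _ else _) (dec-true (agree? M f u) p)

  patch-out : ∀ {g s} → ¬ Agree M f u → patch M f g s u ≡ s u
  patch-out {M = M} {f = f} {u = u} p = cong (if_then _ else _) (dec-false (agree? M f u) p)

abstract

  splice : List (Fin n) → Vec Bool n → Vec Bool n → Vec Bool n
  splice G x y = tabulate λ i → if does (i ∈? G) then lookup x i else lookup y i

  splice-in : ∀ {x y} → i ∈ G → lookup (splice {n} G x y) i ≡ lookup x i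
  splice-in {i = i} {G} p =
    trans (lookup∘tabulate _ i) (cong (if_then _ else _) (dec-true (i ∈? G) p))

  splice-out : ∀ {x y} → i ∉ G → lookup (splice {n} G x y) i ≡ lookup y i
  splice-out {i = i} {G} p =
    trans (lookup∘tabulate _ i) (cong (if_then _ else _) (dec-false (i ∈? G) p))

-- Fresh coordinates and subcubes without queries

fresh : (G : List (Fin n)) → length G < n → ∃ λ i → i ∉ G
fresh G lt with Fin.any? (λ i → ¬? (i ∈? G))
... | yes p = p
-- Otherwise positions in `G` would embed `Fin n` into `Fin (length G)`.
... | no ¬p = contradiction
  (Fin.injective⇒≤ {f = λ i → Any.index (every i)}
    (λ {i} {j} → index-injective (setoid _) (every i) (every j))) (<⇒≱ lt)
  where
  every : ∀ i → i ∈ G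
  every i = decidable-stable (i ∈? G) (λ i∉G → ¬p (i , i∉G))

side : Fin n → Bool → List (Vertex n) → List (Vertex n)
side j b = filter (λ q → lookup q j Bool.≟ b)

length-sides : ∀ (j : Fin n) Q → length (side j true Q) + length (side j false Q) ≡ length Q
length-sides j []      = refl
length-sides j (q ∷ Q) with lookup q j
... | true  = cong suc (length-sides j Q)
... | false = trans (+-suc _ _) (cong suc (length-sides j Q))

light-side : ∀ (j : Fin n) Q {k} → length Q < 2 * k → ∃ λ b → length (side j b Q) < k
light-side j Q {k} lt with length (side j true Q) <? k
... | yes p = true , p
... | no ¬p = false , +-cancelˡ-< k _ _ (begin-strict
  k + length (side j false Q)                      ≤⟨ +-monoˡ-≤ _ (≮⇒≥ ¬p) ⟩
  length (side j true Q) + length (side j false Q) ≡⟨ length-sides j Q ⟩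
  length Q                                         <⟨ lt ⟩
  2 * k                                            ≡⟨ cong (k +_) (+-identityʳ k) ⟩
  k + k                                            ∎)
  where open ≤-Reasoning

Misses : List (Fin n) → Vertex n → Vertex n → Set
Misses D f q = Any (Differ q f) D

-- A query on the other side of direction `j` misses through `j` itself.
missing-side : ∀ {D} (f : Vertex n) j Q →
               All (Misses D f) (side j (lookup f j) Q) → All (Misses (j ∷ D) f) Q
missing-side f j []      _ = []
missing-side f j (q ∷ Q) p with lookup q j Bool.≟ lookup f j
... | yes _  = there (All.head p) ∷ missing-side f j Q (All.tail p)
... | no  ne = here ne ∷ missing-side f j Q p

-- Fixing a fresh coordinate to the side with fewer queries halves the bound `2 ^ d`; at `d = 0` no
-- query is left. Since `f′` agrees with `f` on `G`, and so on `M`, the new subcube will lie in the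
-- current one.
missing-subcube : ∀ d (G : List (Fin n)) Q f → length G + d ≤ n → length Q < 2 ^ d →
  ∃₂ λ D f′ → length D ≡ d × (∀ {i} → i ∈ D → i ∉ G) × Agree G f f′ × All (Misses D f′) Q
missing-subcube zero    G []      f _  _          = [] , f , refl , (λ ()) , Agree-refl , []
missing-subcube zero    G (_ ∷ _) f _  (s≤s ())
missing-subcube {n} (suc d) G Q   f le lt
  with j , j∉G ← fresh G (<-≤-trans (m<m+n _ z<s) le)
  with b , ltb ← light-side j Q lt
  with D , f′ , lenD , D∩ , f~f′ , miss ←
    missing-subcube d (j ∷ G) (side j b Q) (f [ j ]≔ b) (subst (_≤ n) (+-suc _ d) le) ltb
  with refl ← trans (sym (agrees f~f′ (here refl))) (lookup∘update j f b) =
  j ∷ D , f′ , cong suc lenD ,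
  (λ { (here refl) → j∉G ; (there i∈D) i∈G → D∩ i∈D (there i∈G) }) ,
  mk (λ i∈G → trans
    (sym (lookup∘update′ (λ { refl → j∉G i∈G }) f _)) (agrees f~f′ (there i∈G))) ,
  missing-side f′ j Q miss

-- The state of the adversary

-- The game is played in the subcube F = { u | u agrees with f on M }, and the
-- labels are the coordinates in G but not in M. For a vertex u that agrees on G
-- with some query in Q, rep u is this query; otherwise rep u is irrelevant.
record Position (M : List (Fin n)) (f : Vertex n) (G : List (Fin n)) (s : Outmap n)
                (rep : Vertex n → Vertex n) (Q : List (Vertex n)) : Set where
  field
    M⊆G       : ∀ {i} → i ∈ M → i ∈ G
    outgoing  : ∀ {u} → ¬ Agree M f u → ∃ λ i → i ∈ M × Differ u f i × lookup (s u) i ≡ true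
    inner     : ∀ {u i} → Agree M f u → i ∈ M → lookup (s u) i ≡ false
    free      : ∀ {u i} → Agree M f u → i ∉ G → lookup (s u) i ≡ true
    sep-out   : ∀ {u v} → ¬ Agree M f u → ¬ Agree M f v → u ≢ v → Separated s u v
    sep-in    : ∀ {u v} → Agree M f u → Agree M f v → ¬ Agree G u v →
                ∃ λ i → i ∈ G × Separates s u v i
    rep-cong  : ∀ {u v} → Agree G u v → rep u ≡ rep v
    rep-fixed : ∀ {q} → q ∈ Q → rep q ≡ q
    Q⊆F       : ∀ {q} → q ∈ Q → Agree M f q

open Position

-- Answering a query

module _ {M : List (Fin n)} {f : Vertex n} {G : List (Fin n)} {s : Outmap n}
         {rep : Vertex n → Vertex n} {Q : List (Vertex n)} (pos : Position M f G s rep Q) where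

  Position⇒¬Sink : length G < n → ¬ Sink s u
  Position⇒¬Sink {u = u} lt with agree? M f u
  ... | yes p with i , i∉G ← fresh G lt = ¬Sink-by s (free pos p i∉G)
  ... | no ¬p with _ , _ , _ , out ← outgoing pos ¬p = ¬Sink-by s out

  -- The edge of direction j at u is directed away from rep u.
  refine : Fin n → Outmap n
  refine j = patch M f (λ u → s u [ j ]≔ not (lookup u j xor lookup (rep u) j)) s

  refine-same : ∀ {j} u → ¬ Agree M f u → refine j u ≡ s u
  refine-same u = patch-out

  refine-at : Agree M f u → lookup (refine j u) j ≡ not (lookup u j xor lookup (rep u) j)
  refine-at {u = u} {j} p = trans (patch-in p at j) (lookup∘update j (s u) _)

  refine-off : Agree M f u → i ≢ j → lookup (refine j u) i ≡ lookup (s u) i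
  refine-off {u = u} {i} p i≢j =
    trans (patch-in p at i) (lookup∘update′ i≢j (s u) _)

  -- A query is its own representative, so its edge in direction `j` points outward, as `free` had
  -- already answered.
  refine-fixed : ∀ {j q} → j ∉ G → q ∈ Q → refine j q ≡ s q
  refine-fixed {j} {q} j∉G q∈Q = lookup-ext λ i → helper i (i Fin.≟ j)
    where
    helper : ∀ i → Dec (i ≡ j) → lookup (refine j q) i ≡ lookup (s q) i
    helper i (no i≢j)   = refine-off (Q⊆F pos q∈Q) i≢j
    helper i (yes refl) = begin
      lookup (refine j q) j                   ≡⟨ refine-at (Q⊆F pos q∈Q) ⟩
      not (lookup q j xor lookup (rep q) j)   ≡⟨ cong (λ x → not (lookup q j xor lookup x j)) (rep-fixed pos q∈Q) ⟩
      not (lookup q j xor lookup q j)         ≡⟨ cong not (Bool.xor-same (lookup q j)) ⟩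
      true                                    ≡⟨ free pos (Q⊆F pos q∈Q) j∉G ⟨
      lookup (s q) j                          ∎
      where open ≡-Reasoning

  refine-position : ∀ {j} → j ∉ G → Position M f (j ∷ G) (refine j) rep Q
  refine-position {j} j∉G = record
    { M⊆G       = there ∘ M⊆G pos
    ; outgoing  = λ {u} p → let i , i∈M , d , out = outgoing pos p in
                  i , i∈M , d , trans (patch-out p at i) out
    ; inner     = λ p i∈M → trans (refine-off p (λ { refl → j∉G (M⊆G pos i∈M) })) (inner pos p i∈M)
    ; free      = λ p i∉ → trans (refine-off p (i∉ ∘ here)) (free pos p (i∉ ∘ there))
    ; sep-out   = λ {u} {v} p q u≢v → let i , d , e = sep-out pos p q u≢v in
                  i , d , subst₂ (λ x y → Differ x y i) (sym (patch-out p)) (sym (patch-out q)) e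
    ; sep-in    = sep
    ; rep-cong  = rep-cong pos ∘ Agree-tail
    ; rep-fixed = rep-fixed pos
    ; Q⊆F       = Q⊆F pos
    }
    where
    sep : ∀ {u v} → Agree M f u → Agree M f v → ¬ Agree (j ∷ G) u v →
          ∃ λ i → i ∈ j ∷ G × Separates (refine j) u v i
    sep {u} {v} p q ne with agree? G u v
    ... | no ne′ with i , i∈G , d , e ← sep-in pos p q ne′ =
      i , there i∈G , d , subst₂ _≢_ (sym (refine-off p i≢j)) (sym (refine-off q i≢j)) e
      where
      i≢j : i ≢ j
      i≢j refl = j∉G i∈G
    -- Vertices with equal old labels share a representative, so bit `j` of the outmap is an
    -- injective function of bit `j` of the vertex.
    ... | yes agree = j , here refl , d , λ eq → d (xor-cancelʳ _ _ (lookup (rep u) j)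
      (Bool.not-injective (begin
        not (lookup u j xor lookup (rep u) j)  ≡⟨ refine-at p ⟨
        lookup (refine j u) j                  ≡⟨ eq ⟩
        lookup (refine j v) j                  ≡⟨ refine-at q ⟩
        not (lookup v j xor lookup (rep v) j)
          ≡⟨ cong (λ x → not (lookup v j xor lookup x j)) (rep-cong pos agree) ⟨
        not (lookup v j xor lookup (rep u) j)  ∎)))
      where
      open ≡-Reasoning
      d : Differ u v j
      d eq = ne (mk λ { (here refl) → eq ; (there i∈G) → agrees agree i∈G })

  -- Covers repeated queries, and a first query that happens to be the default representative of its
  -- class.
  insert-known : Agree M f w → rep w ≡ w → Position M f G s rep (w ∷ Q)
  insert-known p eq = record
    { Position pos
    ; rep-fixed = λ { (here refl) → eq ; (there q∈Q) → rep-fixed pos q∈Q }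
    ; Q⊆F       = λ { (here refl) → p ; (there q∈Q) → Q⊆F pos q∈Q }
    }

  abstract

    insert-rep : Vertex n → Vertex n → Vertex n
    insert-rep w u = if does (agree? G w u) then w else rep u

    insert-rep-in : Agree G w u → insert-rep w u ≡ w
    insert-rep-in {w = w} {u} p = cong (if_then _ else _) (dec-true (agree? G w u) p)

    insert-rep-out : ¬ Agree G w u → insert-rep w u ≡ rep u
    insert-rep-out {w = w} {u} p = cong (if_then _ else _) (dec-false (agree? G w u) p)

  -- An earlier query with the labels of `w` would equal `rep w`, which differs from `w` at `j`. So
  -- the class of `w` holds no query yet and can take `w` as its representative.
  insert-new : Agree M f w → j ∈ G → Differ (rep w) w j → Position M f G s (insert-rep w) (w ∷ Q)
  insert-new {w = w} {j} p j∈G d = record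
    { Position pos
    ; rep-cong  = insert-cong
    ; rep-fixed = λ { (here refl) → insert-rep-in Agree-refl
                    ; (there q∈Q) → trans (insert-rep-out (not-in q∈Q)) (rep-fixed pos q∈Q) }
    ; Q⊆F       = λ { (here refl) → p ; (there q∈Q) → Q⊆F pos q∈Q }
    }
    where
    not-in : ∀ {q} → q ∈ Q → ¬ Agree G w q
    not-in {q} q∈Q agree = d (begin
      lookup (rep w) j  ≡⟨ rep-cong pos agree at j ⟩
      lookup (rep q) j  ≡⟨ rep-fixed pos q∈Q at j ⟩
      lookup q j        ≡⟨ agrees agree j∈G ⟨
      lookup w j        ∎)
      where open ≡-Reasoning

    insert-cong : ∀ {u v} → Agree G u v → insert-rep w u ≡ insert-rep w v
    insert-cong {u} {v} agree with agree? G w u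
    ... | yes q = trans (insert-rep-in q) (sym (insert-rep-in (Agree-trans q agree)))
    ... | no ¬q = trans (insert-rep-out ¬q) (trans (rep-cong pos agree)
      (sym (insert-rep-out (λ q → ¬q (Agree-trans q (Agree-sym agree))))))

  -- Closing a round and passing to a smaller subcube

  module _ {D : List (Fin n)} {f′ : Vertex n} (D∩G : ∀ {i} → i ∈ D → i ∉ G)
           (f~f′ : Agree G f f′) (miss : All (Misses D f′) Q) where

    M′ : List (Fin n)
    M′ = D ++ M

    -- F′ is the subcube of the vertices that agree with f′ on M′. Within a class
    -- of vertices that agree on G, those on the far side of F′ in some direction
    -- in which the query of the class is also on the far side are directed away
    -- from this query, and the others towards f′.
    Behind : Vertex n → Fin n → Set
    Behind u i = Differ (rep u) f′ i × Differ u f′ i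

    behind? : ∀ u → Dec (Any (Behind u) D)
    behind? u = any? (λ i → ¬? (_ Bool.≟ _) ×-dec ¬? (_ Bool.≟ _)) D

    abstract

      -- For fixed `x`, the outmap `u ⊕ x` directs all edges towards `x`; if `x` is the antipode of
      -- `rep u`, this means away from `rep u`.
      pivot : Vertex n → Vertex n
      pivot u = if does (behind? u) then map not (rep u) else f′

      pivot-yes : Any (Behind u) D → pivot u ≡ map not (rep u)
      pivot-yes {u = u} p = cong (if_then _ else _) (dec-true (behind? u) p)

      pivot-no : ¬ Any (Behind u) D → pivot u ≡ f′
      pivot-no {u = u} p = cong (if_then _ else _) (dec-false (behind? u) p)

    -- The zeros on `M′` inside `F′` separate its vertices from all others, which have an outgoing
    -- edge in a direction of `M′` that leads towards `F′`. The ones elsewhere are the opening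
    -- answers of the next round.
    settle : Outmap n
    settle = patch M′ f′ (const (splice M′ 0ⁿ (replicate n true)))
            (patch M f (λ u → splice G (s u) (u ⊕ pivot u)) s)

    F′⇒F : Agree M′ f′ u → Agree M f u
    F′⇒F p = mk λ i∈M →
      trans (agrees f~f′ (M⊆G pos i∈M)) (agrees p (∈-++⁺ʳ D i∈M))

    settle-F′ : Agree M′ f′ u → settle u ≡ splice M′ 0ⁿ (replicate n true)
    settle-F′ = patch-in

    settle-outside : ¬ Agree M f u → settle u ≡ s u
    settle-outside p = trans (patch-out (p ∘ F′⇒F)) (patch-out p)

    settle-ring : Agree M f u → ¬ Agree M′ f′ u → settle u ≡ splice G (s u) (u ⊕ pivot u)
    settle-ring p p′ = trans (patch-out p′) (patch-in p)

    settle-in : Agree M f u → ¬ Agree M′ f′ u → i ∈ G → lookup (settle u) i ≡ lookup (s u) i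
    settle-in {i = i} p p′ i∈G =
      trans (settle-ring p p′ at i) (splice-in {G = G} i∈G)

    settle-off : Agree M f u → ¬ Agree M′ f′ u → i ∉ G →
                 lookup (settle u) i ≡ lookup u i xor lookup (pivot u) i
    settle-off {u = u} {i} p p′ i∉G =
      trans (settle-ring p p′ at i)
            (trans (splice-out {G = G} {x = s u} i∉G) (lookup-zipWith _xor_ i u (pivot u)))

    settle-behind : Agree M f u → ¬ Agree M′ f′ u → Any (Behind u) D → i ∉ G →
                    lookup u i ≡ lookup (rep u) i → lookup (settle u) i ≡ true
    settle-behind {u = u} {i} p p′ b i∉G eq = begin
      lookup (settle u) i                        ≡⟨ settle-off p p′ i∉G ⟩
      lookup u i xor lookup (pivot u) i          ≡⟨ cong (λ x → lookup u i xor lookup x i) (pivot-yes b) ⟩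
      lookup u i xor lookup (map not (rep u)) i  ≡⟨ cong (lookup u i xor_) (lookup-map i not (rep u)) ⟩
      lookup u i xor not (lookup (rep u) i)      ≡⟨ cong (λ x → lookup u i xor not x) eq ⟨
      lookup u i xor not (lookup u i)            ≡⟨ Bool.xor-inverseʳ (lookup u i) ⟩
      true                                       ∎
      where open ≡-Reasoning

    settle-front : Agree M f u → ¬ Agree M′ f′ u → ¬ Any (Behind u) D → i ∉ G →
                   lookup (settle u) i ≡ lookup u i xor lookup f′ i
    settle-front {u = u} {i} p p′ b i∉G =
      trans (settle-off p p′ i∉G) (cong (λ x → lookup u i xor lookup x i) (pivot-no b))

    missed : ∀ {q} → q ∈ Q → ¬ Agree M′ f′ q
    missed q∈Q p with i , i∈D , d ← find (All.lookup miss q∈Q) =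
      d (sym (agrees p (∈-++⁺ˡ i∈D)))

    -- A query misses `F′` and represents itself, so it is `Behind` in some direction of `D`. Its
    -- bits outside `G` are then all 1, as `free` had them.
    settle-fixed : ∀ {q} → q ∈ Q → settle q ≡ s q
    settle-fixed {q} q∈Q = lookup-ext λ i → helper i (i ∈? G)
      where
      behind : Any (Behind q) D
      behind = Any.map (λ {i} d → d ∘ trans (sym (rep-fixed pos q∈Q) at i) , d)
                       (All.lookup miss q∈Q)

      helper : ∀ i → Dec (i ∈ G) → lookup (settle q) i ≡ lookup (s q) i
      helper i (yes i∈G) = settle-in (Q⊆F pos q∈Q) (missed q∈Q) i∈G
      helper i (no i∉G)  = trans
        (settle-behind (Q⊆F pos q∈Q) (missed q∈Q) behind i∉G
          (sym (rep-fixed pos q∈Q) at i))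
        (sym (free pos (Q⊆F pos q∈Q) i∉G))

    -- Outside `F` the old direction serves. In `F`, a vertex that is behind lies on the side of its
    -- representative in a direction of `D`, so that edge leaves; any other vertex differs from `f′`
    -- in `D` and points towards it.
    settle-outgoing : ¬ Agree M′ f′ u →
                      ∃ λ i → i ∈ M′ × Differ u f′ i × lookup (settle u) i ≡ true
    settle-outgoing {u = u} p′ with agree? M f u
    ... | no ¬p with i , i∈M , d , out ← outgoing pos ¬p =
      i , ∈-++⁺ʳ D i∈M , (λ eq → d (trans eq (sym (agrees f~f′ (M⊆G pos i∈M))))) ,
      trans (settle-outside ¬p at i) out
    ... | yes p with behind? u
    ...   | yes b with i , i∈D , d , e ← find b =
      i , ∈-++⁺ˡ i∈D , e , settle-behind p p′ b (D∩G i∈D) (≢⇒≡ e d)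
    ...   | no ¬b with i , i∈M′ , d ← ¬Agree⇒Differ M′ p′ | ∈-++⁻ D i∈M′
    ...     | inj₁ i∈D = i , i∈M′ , d ∘ sym , trans (settle-front p p′ ¬b (D∩G i∈D)) (≢⇒xor (d ∘ sym))
    ...     | inj₂ i∈M = contradiction
      (trans (sym (agrees f~f′ (M⊆G pos i∈M))) (agrees p i∈M)) d

    -- Where `u` is behind, `v` has the same representative but is not behind, so it is on the side
    -- of `f′`: the edge leaves `u` but not `v`.
    settle-sep-half : Agree M f u → ¬ Agree M′ f′ u → Agree M f v → ¬ Agree M′ f′ v →
                      Agree G u v → Any (Behind u) D → ¬ Any (Behind v) D → Separated settle u v
    settle-sep-half {u = u} {v} p p′ q q′ agree b ¬b with i , i∈D , d , e ← find b =
      i , (λ eq → e (trans eq v≡f′)) ,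
      true≢false (settle-behind p p′ b (D∩G i∈D) (≢⇒≡ e d))
        (trans (settle-front q q′ ¬b (D∩G i∈D))
          (trans (cong (_xor lookup f′ i) v≡f′) (Bool.xor-same (lookup f′ i))))
      where
      v≡f′ : lookup v i ≡ lookup f′ i
      v≡f′ = decidable-stable (_ Bool.≟ _) λ ne →
        ¬b (lose i∈D (subst (λ x → Differ x f′ i) (rep-cong pos agree) d , ne))

    settle-sep-pivot : Agree M f u → ¬ Agree M′ f′ u → Agree M f v → ¬ Agree M′ f′ v →
                       Agree G u v → u ≢ v → pivot u ≡ pivot v → Separated settle u v
    settle-sep-pivot {u = u} {v} p p′ q q′ agree u≢v eq with i , d ← ≢⇒Differ u≢v =
      i , d , λ same → d (xor-cancelʳ _ _ (lookup (pivot u) i) (begin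
        lookup u i xor lookup (pivot u) i  ≡⟨ settle-off p p′ i∉G ⟨
        lookup (settle u) i                ≡⟨ same ⟩
        lookup (settle v) i                ≡⟨ settle-off q q′ i∉G ⟩
        lookup v i xor lookup (pivot v) i  ≡⟨ cong (λ x → lookup v i xor lookup x i) eq ⟨
        lookup v i xor lookup (pivot u) i  ∎))
      where
      open ≡-Reasoning
      i∉G : i ∉ G
      i∉G i∈G = d (agrees agree i∈G)

    settle-sep-ring : Agree M f u → ¬ Agree M′ f′ u → Agree M f v → ¬ Agree M′ f′ v →
                      u ≢ v → Separated settle u v
    settle-sep-ring {u = u} {v} p p′ q q′ u≢v with agree? G u v
    -- This direction lies in `G`, where `settle` keeps the bits of `s`.
    ... | no ne with i , i∈G , d , e ← sep-in pos p q ne =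
      i , d , subst₂ _≢_ (sym (settle-in p p′ i∈G)) (sym (settle-in q q′ i∈G)) e
    ... | yes agree with behind? u | behind? v
    ...   | yes b | no ¬b = settle-sep-half p p′ q q′ agree b ¬b
    ...   | no ¬b | yes b =
      Separated-sym {s = settle} (settle-sep-half q q′ p p′ (Agree-sym agree) b ¬b)
    ...   | yes b | yes c = settle-sep-pivot p p′ q q′ agree u≢v
      (trans (pivot-yes b) (trans (cong (map not) (rep-cong pos agree)) (sym (pivot-yes c))))
    ...   | no ¬b | no ¬c = settle-sep-pivot p p′ q q′ agree u≢v
      (trans (pivot-no ¬b) (sym (pivot-no ¬c)))

    settle-sep-mixed : ¬ Agree M f u → Agree M f v → ¬ Agree M′ f′ v → Separated settle u v
    settle-sep-mixed ¬p q q′ with i , i∈M , d , out ← outgoing pos ¬p =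
      i , (λ eq → d (trans eq (sym (agrees q i∈M)))) ,
      true≢false (trans (settle-outside ¬p at i) out)
                 (trans (settle-in q q′ (M⊆G pos i∈M)) (inner pos q i∈M))

    settle-sep-out : ¬ Agree M′ f′ u → ¬ Agree M′ f′ v → u ≢ v → Separated settle u v
    settle-sep-out {u = u} {v} p′ q′ u≢v with agree? M f u | agree? M f v
    ... | yes p | yes q = settle-sep-ring p p′ q q′ u≢v
    ... | no ¬p | yes q = settle-sep-mixed ¬p q q′
    ... | yes p | no ¬q = Separated-sym {s = settle} (settle-sep-mixed ¬q p p′)
    ... | no ¬p | no ¬q with i , d , e ← sep-out pos ¬p ¬q u≢v =
      i , d , subst₂ (λ x y → Differ x y i) (sym (settle-outside ¬p)) (sym (settle-outside ¬q)) e

    -- The labels of the finished round are not fixed in `F′` and can be used afresh; only the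
    -- coordinates in `D` are spent.
    settle-position : Position M′ f′ M′ settle (const f′) []
    settle-position = record
      { M⊆G       = λ i∈ → i∈
      ; outgoing  = settle-outgoing
      ; inner     = λ {u} {i} p i∈ → trans (settle-F′ p at i)
                      (trans (splice-in {G = M′} i∈) (lookup-replicate i false))
      ; free      = λ {u} {i} p i∉ → trans (settle-F′ p at i)
                      (trans (splice-out {G = M′} {x = 0ⁿ} i∉) (lookup-replicate i true))
      ; sep-out   = settle-sep-out
      ; sep-in    = λ p q ne → contradiction (Agree-trans (Agree-sym p) q) ne
      ; rep-cong  = λ _ → refl
      ; rep-fixed = λ ()
      ; Q⊆F       = λ ()
      }

-- Filling the last subcube

complete-mixed : ∀ {s : Outmap n} {rep} → Position M f M s rep [] →
                 ¬ Agree M f u → Agree M f v → Separated (patch M f (_⊕ f) s) u v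
complete-mixed {M = M} {f = f} {u} {v} {s = s} pos ¬p q with i , i∈M , d , out ← outgoing pos ¬p =
  i , (λ eq → d (trans eq (sym (agrees q i∈M)))) ,
  true≢false (trans (patch-out ¬p at i) out) (begin
    lookup (patch M f (_⊕ f) s v) i
                               ≡⟨ patch-in q at i ⟩
    lookup (v ⊕ f) i           ≡⟨ lookup-zipWith _xor_ i v f ⟩
    lookup v i xor lookup f i  ≡⟨ cong (lookup v i xor_) (agrees q i∈M) ⟩
    lookup v i xor lookup v i  ≡⟨ Bool.xor-same (lookup v i) ⟩
    false                      ∎)
  where open ≡-Reasoning

-- On `F` the outmap `u ⊕ f` is injective and vanishes on `M`, which separates vertices of `F` from
-- each other and from the rest.
complete : ∀ {s : Outmap n} {rep} → Position M f M s rep [] → ClashFree (patch M f (_⊕ f) s)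
complete {M = M} {f = f} {s = s} pos {u} {v} u≢v with agree? M f u | agree? M f v
... | no ¬p | yes q = complete-mixed pos ¬p q
... | yes p | no ¬q = Separated-sym {s = patch M f (_⊕ f) s} (complete-mixed pos ¬q p)
... | no ¬p | no ¬q with i , d , e ← sep-out pos ¬p ¬q u≢v =
  i , d , subst₂ (λ x y → Differ x y i) (sym (patch-out ¬p)) (sym (patch-out ¬q)) e
... | yes p | yes q with i , d ← ≢⇒Differ u≢v =
  i , d , λ eq → d (xor-cancelʳ _ _ (lookup f i) (begin
    lookup u i xor lookup f i        ≡⟨ lookup-zipWith _xor_ i u f ⟨
    lookup (u ⊕ f) i                 ≡⟨ patch-in p at i ⟨
    lookup (patch M f (_⊕ f) s u) i  ≡⟨ eq ⟩
    lookup (patch M f (_⊕ f) s v) i  ≡⟨ patch-in q at i ⟩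
    lookup (v ⊕ f) i                 ≡⟨ lookup-zipWith _xor_ i v f ⟩
    lookup v i xor lookup f i        ∎))
  where open ≡-Reasoning

-- The strategy over all rounds

NoSinkIn : ℕ → Algorithm n → Outmap n → Set
NoSinkIn K A s = All (¬_ ∘ Sink s) (take K (queried A s))

NoSinkIn-query : ∀ {K x} {s : Outmap n} next → s w ≡ x → x ≢ 0ⁿ →
                 NoSinkIn K (next x) s → NoSinkIn (suc K) (query w next) s
NoSinkIn-query next refl ¬sink none = ¬sink ∷ none

-- `s₀` is binding outside the current subcube and on the queries of the running round only.
Completion : List (Fin n) → Vertex n → Outmap n → List (Vertex n) → ℕ → Algorithm n → Set
Completion {n} M f s₀ Q K A = Σ (Outmap n) λ s →
  ClashFree s × (∀ {u} → ¬ Agree M f u → s u ≡ s₀ u) × (∀ {q} → q ∈ Q → s q ≡ s₀ q) ×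
  NoSinkIn K A s

module _ {m d : ℕ} (0<d : 0 < d) (m<2^d : m < 2 ^ d) where

  -- Each of the `p` remaining rounds fixes `d` more coordinates; the summand `m` is room for the
  -- labels of one round.
  Evades : ℕ → ℕ → Set
  Evades n p = ∀ {M f s rep} → Position {n} M f M s rep [] → length M + p * d + m ≤ n →
               ∀ A → Completion M f s [] (p * m) A

  module _ {p a : ℕ} (le : a + suc p * d + m ≤ n) where

    room : a + m + d ≤ n
    room = ≤-trans (begin
      a + m + d            ≡⟨ +-assoc a m d ⟩
      a + (m + d)          ≤⟨ +-monoʳ-≤ a (+-monoʳ-≤ m (m≤m+n d (p * d))) ⟩
      a + (m + suc p * d)  ≡⟨ cong (a +_) (+-comm m (suc p * d)) ⟩
      a + (suc p * d + m)  ≡⟨ +-assoc a (suc p * d) m ⟨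
      a + suc p * d + m    ∎) le
      where open ≤-Reasoning

    room-next : d + a + p * d + m ≤ n
    room-next = ≤-trans (≤-reflexive (cong (_+ m) (begin
      d + a + p * d    ≡⟨ cong (_+ p * d) (+-comm d a) ⟩
      a + d + p * d    ≡⟨ +-assoc a d (p * d) ⟩
      a + suc p * d    ∎))) le
      where open ≡-Reasoning

  module _ {p : ℕ} (evades : Evades n p) where

    -- Induction on the `k` queries left in the round. Each adds at most one label and one entry of
    -- `Q`; at `k = 0` there are fewer than `2 ^ d` entries, so a subcube without queries exists.
    round : ∀ {s rep Q} k → Position {n} M f G s rep Q →
            length M + suc p * d + m ≤ n → length G + k ≤ length M + m → length Q + k ≤ m →
            ∀ A → Completion M f s Q (k + p * m) A
    round {M = M} {f = f} {G = G} {Q = Q} zero pos le leG leQ A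
      with D , f′ , refl , D∩G , f~f′ , miss ← missing-subcube d G Q f
             (≤-trans (+-monoˡ-≤ d (≤-trans (m≤m+n _ 0) leG)) (room {p = p} le))
             (≤-<-trans (≤-trans (m≤m+n _ 0) leQ) m<2^d)
      with s , cf , out , _ , none ←
        evades (settle-position pos D∩G f~f′ miss)
          (subst (λ x → x + p * d + m ≤ n) (sym (length-++ D)) (room-next {p = p} le)) A =
      s , cf ,
      (λ ¬p → trans (out (¬p ∘ F′⇒F pos D∩G f~f′ miss)) (settle-outside pos D∩G f~f′ miss ¬p)) ,
      (λ q∈Q → trans (out (missed pos D∩G f~f′ miss q∈Q)) (settle-fixed pos D∩G f~f′ miss q∈Q)) ,
      none
    -- An early stop still calls for a complete outmap, so the round is run to its end.
    round (suc k) pos le leG leQ stop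
      with s′ , cf , out , fixed , _ ←
        round k pos le (≤-trans (+-monoʳ-≤ _ (n≤1+n k)) leG) (≤-trans (+-monoʳ-≤ _ (n≤1+n k)) leQ) stop =
      s′ , cf , out , fixed , []
    round {M = M} {f = f} {G = G} {s = s} {rep = rep} {Q = Q} (suc k) pos le leG leQ (query w next) =
      answer (agree? M f w)
      where
      sucG : suc (length G) + k ≤ length M + m
      sucG = subst (_≤ length M + m) (+-suc _ k) leG

      sucQ : suc (length Q) + k ≤ m
      sucQ = subst (_≤ m) (+-suc _ k) leQ

      lt : suc (length G) < n
      lt = <-≤-trans (≤-<-trans (≤-trans (m≤m+n _ k) sucG) (m<m+n _ 0<d)) (room {p = p} le)

      extend : ∀ {G′ s′ rep′} → Position M f G′ s′ rep′ (w ∷ Q) → length G′ + k ≤ length M + m →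
               length G′ < n → (∀ {u} → ¬ Agree M f u → s′ u ≡ s u) → (∀ {q} → q ∈ Q → s′ q ≡ s q) →
               Completion M f s Q (suc k + p * m) (query w next)
      extend {s′ = s′} pos′ leG′ lt′ outside fixed
        -- The final outmap keeps the answer `s′ w`, so the algorithm indeed continues with
        -- `next (s′ w)`.
        with s* , cf , out , fixed* , none ← round k pos′ le leG′ sucQ (next (s′ w)) =
        s* , cf , (λ ¬p → trans (out ¬p) (outside ¬p)) ,
        (λ q∈Q → trans (fixed* (there q∈Q)) (fixed q∈Q)) ,
        NoSinkIn-query next (fixed* (here refl)) (Position⇒¬Sink pos′ lt′) none

      answer : Dec (Agree M f w) → Completion M f s Q (suc k + p * m) (query w next)
      -- Outside `F` the answer is final already, and no label is spent.
      answer (no ¬p)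
        with s* , cf , out , fixed , none ←
          round k pos le (≤-trans (n≤1+n _) sucG) (≤-trans (n≤1+n _) sucQ) (next (s w)) =
        s* , cf , out , fixed ,
        NoSinkIn-query next (out ¬p) (Position⇒¬Sink pos (<-trans (n<1+n _) lt)) none
      answer (yes p) with ≡-dec Bool._≟_ (rep w) w
      ... | yes eq = extend (insert-known pos p eq)
        (≤-trans (n≤1+n _) sucG) (<-trans (n<1+n _) lt) (λ _ → refl) (λ _ → refl)
      ... | no ne with j , d ← ≢⇒Differ ne | j ∈? G
      ...   | yes j∈G = extend (insert-new pos p j∈G d)
        (≤-trans (n≤1+n _) sucG) (<-trans (n<1+n _) lt) (λ _ → refl) (λ _ → refl)
      -- The new label is a coordinate in which `w` and `rep w` differ.
      ...   | no j∉G = extend (insert-new (refine-position pos j∉G) p (here refl) d)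
        sucG lt (λ {u} → refine-same pos u) (refine-fixed pos j∉G)

  evade : ∀ p → Evades n p
  evade zero    {M = M} {f} {s} pos _  A =
    patch M f (_⊕ f) s , complete pos , patch-out , (λ ()) , []
  evade (suc p) pos le A = round {p = p} (evade p) m pos le ≤-refl ≤-refl A

-- From the strategy to the query complexity

initial-position : ∀ (f : Vertex n) → Position [] f [] (const (replicate n true)) (const f) []
initial-position {n} f = record
  { M⊆G       = λ ()
  ; outgoing  = λ ¬p → contradiction (mk λ ()) ¬p
  ; inner     = λ _ ()
  ; free      = λ {u} {i} _ _ → lookup-replicate i true
  ; sep-out   = λ ¬p → contradiction (mk λ ()) ¬p
  ; sep-in    = λ _ _ ¬p → contradiction (mk λ ()) ¬p
  ; rep-cong  = λ _ → refl
  ; rep-fixed = λ ()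
  ; Q⊆F       = λ ()
  }

ClashFree⇒¬Found : ∀ {s : Outmap n} {us} → ClashFree s → All (¬_ ∘ Sink s) us → ¬ Found s us
ClashFree⇒¬Found cf none (inj₁ p) with u , u∈ , sink ← find p = All.lookup none u∈ sink
ClashFree⇒¬Found {s = s} cf none (inj₂ p)
  with u , _ , q ← find p
  with v , _ , clash ← find q = Separated⇒¬Clash {s = s} (cf (proj₁ clash)) clash

-- The value is a variable k, since the definition of t n is an exhaustive search
-- that the type checker would unfold.
MinWorstCase-≥ : ∀ {m d k} p → 0 < d → m < 2 ^ d → p * d + m ≤ n → MinWorstCase n k → p * m ≤ k
MinWorstCase-≥ {m = m} {k = k} p 0<d m<2^d le ((A , solves , _ , worst) , _)
  with s , cf , _ , _ , none ← evade 0<d m<2^d p (initial-position 0ⁿ) le A = ≮⇒≥ λ k<p*m →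
  ClashFree⇒¬Found {s = s} cf
    (subst (All _) (take-all (p * m) _ (≤-trans (worst _ (s , refl)) (<⇒≤ k<p*m))) none)
    (solves s)

-- Choice of the parameters

⌊log₂n⌋≤⌊n/2⌋ : ∀ n → ⌊log₂ n ⌋ ≤ ⌊ n /2⌋
⌊log₂n⌋≤⌊n/2⌋ = <-rec _ step
  where
  open ≤-Reasoning
  step : ∀ n → (∀ {k} → k < n → ⌊log₂ k ⌋ ≤ ⌊ k /2⌋) → ⌊log₂ n ⌋ ≤ ⌊ n /2⌋
  step 0               _  = z≤n
  step 1               _  = z≤n
  step (suc (suc n)) rec = begin
    ⌊log₂ 2 + n ⌋                  ≤⟨ m≤n+m∸n ⌊log₂ 2 + n ⌋ 1 ⟩
    suc (⌊log₂ 2 + n ⌋ ∸ 1)        ≡⟨ cong suc (⌊log₂⌊n/2⌋⌋≡⌊log₂n⌋∸1 (2 + n)) ⟨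
    suc ⌊log₂ suc ⌊ n /2⌋ ⌋        ≤⟨ s≤s (rec (⌊n/2⌋<n (suc n))) ⟩
    suc ⌊ suc ⌊ n /2⌋ /2⌋          ≤⟨ ⌊n/2⌋<n ⌊ n /2⌋ ⟩
    suc ⌊ n /2⌋                    ∎

2*⌊n/2⌋≤n : ∀ n → ⌊ n /2⌋ + ⌊ n /2⌋ ≤ n
2*⌊n/2⌋≤n n = ≤-trans (+-monoʳ-≤ ⌊ n /2⌋ (⌊n/2⌋≤⌈n/2⌉ n)) (≤-reflexive (⌊n/2⌋+⌈n/2⌉≡n n))

-- Otherwise `2 ^ suc ⌊log₂ n ⌋ ≤ n`, and taking logarithms is absurd.
⌊n/2⌋<2^⌊log₂n⌋ : ∀ n → ⌊ n /2⌋ < 2 ^ ⌊log₂ n ⌋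
⌊n/2⌋<2^⌊log₂n⌋ n = ≰⇒> λ le → 1+n≰n (begin
  suc ⌊log₂ n ⌋                  ≡⟨ ⌊log₂[2^n]⌋≡n (suc ⌊log₂ n ⌋) ⟨
  ⌊log₂ 2 ^ suc ⌊log₂ n ⌋ ⌋      ≤⟨ ⌊log₂⌋-mono-≤ (begin
    2 * 2 ^ ⌊log₂ n ⌋                    ≤⟨ *-monoʳ-≤ 2 le ⟩
    2 * ⌊ n /2⌋                          ≡⟨ cong (⌊ n /2⌋ +_) (+-identityʳ _) ⟩
    ⌊ n /2⌋ + ⌊ n /2⌋                    ≤⟨ 2*⌊n/2⌋≤n n ⟩
    n                                    ∎) ⟩
  ⌊log₂ n ⌋                      ∎)
  where open ≤-Reasoning

n≤3*⌊n/2⌋ : 2 ≤ n → n ≤ 3 * ⌊ n /2⌋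
n≤3*⌊n/2⌋ {suc (suc n)} (s≤s (s≤s z≤n)) = s≤s (begin
  suc n                          ≡⟨ cong suc (⌊n/2⌋+⌈n/2⌉≡n n) ⟨
  suc (h + ⌈ n /2⌉)              ≤⟨ s≤s (+-monoʳ-≤ h (⌊n/2⌋-mono (n≤1+n (suc n)))) ⟩
  suc (h + suc h)                ≤⟨ s≤s (+-monoʳ-≤ h (m≤m+n (suc h) (h + 0))) ⟩
  suc (h + (suc h + (h + 0)))    ≡⟨ +-suc h _ ⟨
  h + suc (suc h + (h + 0))      ≡⟨ cong (h +_) (+-suc (suc h) (h + 0)) ⟨
  h + (suc h + suc (h + 0))      ∎)
  where
  open ≤-Reasoning
  h = ⌊ n /2⌋

-- The remainder is at most `d`, hence at most `d * (m / d)`, as the quotient is positive.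
m≤2*[d*[m/d]] : ∀ {m d} .{{_ : NonZero d}} → d ≤ m → m ≤ 2 * (d * (m / d))
m≤2*[d*[m/d]] {m} {d} d≤m = begin
  m                              ≡⟨ m≡m%n+[m/n]*n m d ⟩
  m % d + m / d * d              ≤⟨ +-monoˡ-≤ _ (≤-trans (m%n≤n m d)
                                      (m≤n*m d (m / d) {{>-nonZero (m≥n⇒m/n>0 d≤m)}})) ⟩
  m / d * d + m / d * d          ≡⟨ cong₂ _+_ (*-comm (m / d) d)
                                      (trans (*-comm (m / d) d) (sym (+-identityʳ _))) ⟩
  2 * (d * (m / d))              ∎
  where open ≤-Reasoning

-- The constant 18 is `3 * 3 * 2`: twice `n ≤ 3 * m`, and a factor 2 for rounding in `p = m / d`.
MinWorstCase-≥n²/log : ∀ {e k} → 2 ≤ n → ⌊log₂ n ⌋ ≡ suc e → MinWorstCase n k →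
                       n ^ 2 ≤ 18 * (suc e * k)
MinWorstCase-≥n²/log {n} {e} {k} 2≤n eq min = begin
  n ^ 2                          ≡⟨ cong (n *_) (*-identityʳ n) ⟩
  n * n                          ≤⟨ *-mono-≤ (n≤3*⌊n/2⌋ 2≤n) (n≤3*⌊n/2⌋ 2≤n) ⟩
  3 * m * (3 * m)                ≤⟨ *-monoˡ-≤ (3 * m) (*-monoʳ-≤ 3 (m≤2*[d*[m/d]] d≤m)) ⟩
  3 * (2 * (d * p)) * (3 * m)    ≡⟨ solve 3 (λ d p m → con 3 :* (con 2 :* (d :* p)) :* (con 3 :* m)
                                      := con 18 :* (d :* (p :* m))) refl d p m ⟩
  18 * (d * (p * m))             ≤⟨ *-monoʳ-≤ 18 (*-monoʳ-≤ d (MinWorstCase-≥ p z<s m<2^d fits min)) ⟩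
  18 * (d * k)                   ∎
  where
  open ≤-Reasoning
  open +-*-Solver
  m d p : ℕ
  m = ⌊ n /2⌋
  d = suc e
  p = m / d

  d≤m : d ≤ m
  d≤m = subst (_≤ m) eq (⌊log₂n⌋≤⌊n/2⌋ n)

  m<2^d : m < 2 ^ d
  m<2^d = subst (λ k → m < 2 ^ k) eq (⌊n/2⌋<2^⌊log₂n⌋ n)

  fits : p * d + m ≤ n
  fits = ≤-trans (+-monoˡ-≤ m (m/n*n≤m m d)) (2*⌊n/2⌋≤n n)

-- The bound in rational numbers

fraction-bound : ∀ c e {a b} → a ≤ suc c * (suc e * b) →
                 (ℤ.+ 1 ℚ./ suc c) ℚ.* (ℤ.+ a ℚ./ suc e) ℚ.≤ fromℕ b
fraction-bound c e {a} {b} le = ℚ.toℚᵘ-cancel-≤ (begin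
  ℚ.toℚᵘ ((ℤ.+ 1 ℚ./ suc c) ℚ.* (ℤ.+ a ℚ./ suc e))
    ≃⟨ ℚ.toℚᵘ-homo-* (ℤ.+ 1 ℚ./ suc c) (ℤ.+ a ℚ./ suc e) ⟩
  ℚ.toℚᵘ (ℤ.+ 1 ℚ./ suc c) ℚᵘ.* ℚ.toℚᵘ (ℤ.+ a ℚ./ suc e)
    ≃⟨ ℚᵘ.*-cong (ℚ.toℚᵘ-fromℚᵘ (ℚᵘ.mkℚᵘ (ℤ.+ 1) c)) (ℚ.toℚᵘ-fromℚᵘ (ℚᵘ.mkℚᵘ (ℤ.+ a) e)) ⟩
  ℚᵘ.mkℚᵘ (ℤ.+ 1) c ℚᵘ.* ℚᵘ.mkℚᵘ (ℤ.+ a) e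
    -- With unreduced denominators, the inequality is `le` cross-multiplied.
    ≤⟨ ℚᵘ.*≤* (subst₂ ℤ._≤_ (sym left) (ℤ.pos-* b (suc c * suc e)) (ℤ.+≤+ (≤-trans le (≤-reflexive right)))) ⟩
  ℚᵘ.mkℚᵘ (ℤ.+ b) 0
    ≃⟨ ℚ.toℚᵘ-fromℚᵘ (ℚᵘ.mkℚᵘ (ℤ.+ b) 0) ⟨
  ℚ.toℚᵘ (fromℕ b)
    ∎)
  where
  open ℚᵘ.≤-Reasoning
  left : (ℤ.+ 1 ℤ.* ℤ.+ a) ℤ.* ℤ.+ 1 ≡ ℤ.+ a
  left = trans (ℤ.*-identityʳ _) (ℤ.*-identityˡ _)

  right : suc c * (suc e * b) ≡ b * (suc c * suc e)
  right = trans (sym (*-assoc (suc c) (suc e) b)) (*-comm (suc c * suc e) b)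

n²/log-≤ : ∀ {k} → 2 ≤ n → MinWorstCase n k → (ℤ.+ 1 ℚ./ 18) ℚ.* n²/log n ℚ.≤ fromℕ k
n²/log-≤ {n} {k} 2≤n min with ⌊log₂ n ⌋ in eq
-- For `2 ≤ n` the logarithm is positive, so the dummy quotient does not occur.
... | zero  = contradiction (subst (1 ≤_) eq (⌊log₂⌋-mono-≤ 2≤n)) λ ()
... | suc e = fraction-bound 17 e {b = k} (MinWorstCase-≥n²/log 2≤n eq min)

corollary19 : t ∈Ω n²/log
corollary19 = ℤ.+ 1 ℚ./ 18 , ℚ.positive⁻¹ (ℤ.+ 1 ℚ./ 18) , 2 , λ n 2≤n → n²/log-≤ 2≤n (t-minWorstCase n)
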